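{- Let $n\ge 4$ be given. Then there do not exist homogeneous polynomials $f_1,f_2\in\mathbb{Z}[x_1,\ldots,x_n]$ (of arbitrary degrees, with integer coefficients) such that for every bi-rainbow meander $\mathcal{RM}(\alpha_1,\ldots,\alpha_n)$ (i.e. for all positive integers $\alpha_1,\ldots,\alpha_n$) the number of connected components satisfies $$\mathcal{Z}(\alpha_1,\ldots,\alpha_n)=\gcd\bigl(f_1(\alpha_1,\ldots,\alpha_n),\,f_2(\alpha_1,\ldots,\alpha_n)\bigr).$$
   Context: For positive integers $\alpha_1,\ldots,\alpha_n$ put $\alpha=\sum_{\ell=1}^n\alpha_\ell$. The bi-rainbow meander $\mathcal{RM}(\alpha_1,\ldots,\alpha_n)$ is the planar configuration of arcs with endpoints at the points $1,2,\ldots,2\alpha$ of the horizontal axis, defined as follows. Above the axis there are $n$ rainbow families of nested arcs: with $s_\ell=2\sum_{k<\ell}\alpha_k$, the $\ell$-th family consists of the $\alpha_\ell$ arcs joining $s_\ell+i$ with $s_\ell+2\alpha_\ell+1-i$, $i=1,\ldots,\alpha_\ell$. Below the axis there is one rainbow family of $\alpha$ nested arcs, joining $k$ with $2\alpha+1-k$, $k=1,\ldots,\alpha$. The union of all upper and lower arcs is a disjoint union of closed Jordan curves; $\mathcal{Z}(\alpha_1,\ldots,\alpha_n)$ denotes the number of these curves (connected components). Equivalently, it is the number of orbits on $\{1,\ldots,2\alpha\}$ of the group generated by the two involutions given by the upper and by the lower arcs. -}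

module Defs where

open import Data.Nat.Base using (ℕ; zero; suc; _+_; _*_; _∸_)
open import Data.Nat.Properties as ℕ using ()
open import Data.Integer.Base as ℤ using (ℤ; 0ℤ)
open import Data.Integer.Properties as ℤ using ()
open import Data.Bool.Base using (if_then_else_)
open import Data.Fin.Base using (Fin; toℕ; inject; punchIn; punchOut)
open import Data.Fin.Properties using
  (any?; _≟_; punchOut-cong; punchOut-injective; punchOut-punchIn; punchInᵢ≢i)
open import Data.List.Base using (List; []; _∷_; filter; cartesianProduct; allFin)
open import Data.List.Membership.Propositional using (_∈_)
open import Data.List.Membership.Propositional.Properties using
  (∈-filter⁺; ∈-filter⁻; ∈-cartesianProduct⁺; ∈-allFin)
open import Data.List.Relation.Unary.Any using (here; there)
open import Data.Product.Base using (∃; _×_; _,_; proj₁; proj₂)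
open import Data.Sum.Base using (_⊎_; inj₁; inj₂)
open import Data.Vec.Base as Vec using (Vec)
open import Data.Vec.Properties using (≡-dec)
open import Data.Vec.Functional using (Vector)
open import Algebra.Properties.CommutativeMonoid.Sum ℕ.+-0-commutativeMonoid
  using (sum)
open import Algebra.Properties.CommutativeMonoid.Sum ℤ.*-1-commutativeMonoid
  using () renaming (sum to product)
open import Function.Base using (_∘_; id)
open import Function.Bundles using (Bijection)
open import Level using (0ℓ)
open import Relation.Binary.Bundles using (Setoid)
open import Relation.Binary.Core using (Rel; _⇒_)
open import Relation.Binary.Construct.Closure.Equivalence as Eq using (EqClosure)
open import Relation.Binary.Definitions using (Decidable)
open import Relation.Binary.PropositionalEquality
open import Relation.Nullary using (Dec; yes; no; does; contradiction)
open import Relation.Nullary.Decidable using (_×-dec_; _⊎-dec_)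

-- class presents the classes of the equivalence relation generated by R
-- as the elements of Fin k.
record Classes {m : ℕ} (R : Rel (Fin m) 0ℓ) (k : ℕ) : Set where
  field
    class    : Fin m → Fin k
    sound    : ∀ {x y} → R x y → class x ≡ class y
    complete : ∀ {x y} → class x ≡ class y → EqClosure R x y
    onto     : ∀ c → ∃ λ x → class x ≡ c

private

  -- Identify j with i, and close up the gap left at j.
  module Merge {k : ℕ} (i j : Fin (suc k)) (j≢i : j ≢ i) where

    merge : Fin (suc k) → Fin k
    merge z with j ≟ z
    ... | yes _   = punchOut j≢i
    ... | no  j≢z = punchOut j≢z

    merge-identifies : merge i ≡ merge j
    merge-identifies with j ≟ i | j ≟ j
    ... | yes j≡i | _      = contradiction j≡i j≢i
    ... | no _    | yes _  = punchOut-cong j refl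
    ... | no _    | no j≢j = contradiction refl j≢j

    merge-kernel : ∀ z w → merge z ≡ merge w →
                   z ≡ w ⊎ (z ≡ i × w ≡ j) ⊎ (z ≡ j × w ≡ i)
    merge-kernel z w eq with j ≟ z | j ≟ w
    ... | yes j≡z | yes j≡w = inj₁ (trans (sym j≡z) j≡w)
    ... | yes j≡z | no  j≢w =
      inj₂ (inj₂ (sym j≡z , sym (punchOut-injective j≢i j≢w eq)))
    ... | no  j≢z | yes j≡w =
      inj₂ (inj₁ (punchOut-injective j≢z j≢i eq , sym j≡w))
    ... | no  j≢z | no  j≢w = inj₁ (punchOut-injective j≢z j≢w eq)

    merge-punchIn : ∀ c → merge (punchIn j c) ≡ c
    merge-punchIn c with j ≟ punchIn j c
    ... | yes j≡z = contradiction (sym j≡z) (punchInᵢ≢i j c)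
    ... | no  j≢z = trans (punchOut-cong j refl) (punchOut-punchIn j)

  Edge : ∀ {m} → List (Fin m × Fin m) → Rel (Fin m) 0ℓ
  Edge es x y = (x , y) ∈ es

  addEdge : ∀ {m k} {es : List (Fin m × Fin m)} (a b : Fin m) →
            Classes (Edge es) k → ∃ (Classes (Edge ((a , b) ∷ es)))
  addEdge {k = k} {es} a b C = go k C (Classes.class C a ≟ Classes.class C b)
    where
    es′ = (a , b) ∷ es

    weaken : EqClosure (Edge es) ⇒ EqClosure (Edge es′)
    weaken = Eq.map there

    new : EqClosure (Edge es′) a b
    new = Eq.return (here refl)

    go : ∀ k (C : Classes (Edge es) k) →
         Dec (Classes.class C a ≡ Classes.class C b) → ∃ (Classes (Edge es′))
    go k C (yes a~b) = k , record
      { class    = class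
      ; sound    = λ { (here refl) → a~b ; (there e) → sound e }
      ; complete = weaken ∘ complete
      ; onto     = onto
      }
      where open Classes C
    go zero C (no _) with () ← Classes.class C a
    go (suc k) C (no a≁b) = k , record
      { class    = merge ∘ class
      ; sound    = λ { (here refl) → merge-identifies
                     ; (there e)   → cong merge (sound e) }
      ; complete = λ {x} {y} eq → connect x y (merge-kernel (class x) (class y) eq)
      ; onto     = λ c → proj₁ (onto (punchIn (class b) c)) ,
                         trans (cong merge (proj₂ (onto (punchIn (class b) c))))
                               (merge-punchIn c)
      }
      where
      open Classes C
      open Merge (class a) (class b) (a≁b ∘ sym)
      open Setoid (Eq.setoid (Edge es′)) using () renaming (trans to _▻_; sym to inv)

      connect : ∀ x y → class x ≡ class y
                      ⊎ (class x ≡ class a × class y ≡ class b)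
                      ⊎ (class x ≡ class b × class y ≡ class a) →
                EqClosure (Edge es′) x y
      connect x y (inj₁ x~y) = weaken (complete x~y)
      connect x y (inj₂ (inj₁ (x~a , y~b))) =
        weaken (complete x~a) ▻ (new ▻ weaken (complete (sym y~b)))
      connect x y (inj₂ (inj₂ (x~b , y~a))) =
        weaken (complete x~b) ▻ (inv new ▻ weaken (complete (sym y~a)))

  edgeClasses : ∀ {m} (es : List (Fin m × Fin m)) → ∃ (Classes (Edge es))
  edgeClasses {m} [] = m , record
    { class    = id
    ; sound    = λ ()
    ; complete = λ { refl → Eq.reflexive _ }
    ; onto     = λ c → c , refl
    }
  edgeClasses ((a , b) ∷ es) = addEdge a b (proj₂ (edgeClasses es))

finiteQuotient : ∀ {m} (R : Rel (Fin m) 0ℓ) → Decidable R →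
                 ∃ λ k → Bijection (Eq.setoid R) (setoid (Fin k))
finiteQuotient {m} R R? = proj₁ (edgeClasses es) , record
  { to        = class
  ; cong      = respects
  ; bijective = Eq.map (λ e → proj₂ (∈-filter⁻ R?′ {xs = pairs} e)) ∘ complete
              , λ c → proj₁ (onto c) , λ z~x → trans (respects z~x) (proj₂ (onto c))
  }
  where
  R?′   = λ (e : Fin m × Fin m) → R? (proj₁ e) (proj₂ e)
  pairs = cartesianProduct (allFin m) (allFin m)
  es    = filter R?′ pairs
  open Classes (proj₂ (edgeClasses es))

  respects : ∀ {x y} → EqClosure R x y → class x ≡ class y
  respects = Eq.gfold isEquivalence class λ {x} {y} r →
    sound (∈-filter⁺ R?′ (∈-cartesianProduct⁺ (∈-allFin x) (∈-allFin y)) r)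

-- Elements of Fin m stand for the numbers 1, …, m.
pos : ∀ {m} → Fin m → ℕ
pos x = suc (toℕ x)

-- The a nested arcs joining s + i with s + 2a + 1 - i, for i = 1, …, a.
Rainbow : ∀ {m} (s a : ℕ) → Rel (Fin m) 0ℓ
Rainbow s a x y =
  ∃ λ (i : Fin a) → pos x ≡ s + pos i × pos y ≡ s + 2 * a + 1 ∸ pos i

module _ {n : ℕ} (α : Vector ℕ n) where

  Point : Set
  Point = Fin (2 * sum α)

  offset : Fin n → ℕ
  offset ℓ = 2 * sum (λ (k : Fin (toℕ ℓ)) → α (inject {i = ℓ} k))

  Upper Lower Arc : Rel Point 0ℓ
  Upper x y = ∃ λ (ℓ : Fin n) → Rainbow (offset ℓ) (α ℓ) x y
  Lower     = Rainbow 0 (sum α)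
  Arc x y   = Upper x y ⊎ Lower x y

  -- Two points lie on the same closed curve iff they are joined by a
  -- chain of arcs, so the curves are the classes of this setoid.
  Curves : Setoid 0ℓ 0ℓ
  Curves = Eq.setoid Arc

private
  rainbow? : ∀ {m} s a → Decidable (Rainbow {m} s a)
  rainbow? s a x y = any? λ i →
    (pos x ℕ.≟ s + pos i) ×-dec (pos y ℕ.≟ s + 2 * a + 1 ∸ pos i)

  arc? : ∀ {n} (α : Vector ℕ n) → Decidable (Arc α)
  arc? α x y = any? (λ ℓ → rainbow? (offset α ℓ) (α ℓ) x y)
         ⊎-dec rainbow? 0 (sum α) x y

curves : ∀ {n} (α : Vector ℕ n) →
         ∃ λ k → Bijection (Curves α) (setoid (Fin k))
curves α = finiteQuotient (Arc α) (arc? α)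

-- The number of connected components: the k for which the set of curves
-- is in bijection with Fin k.
𝒵 : ∀ {n} → Vector ℕ n → ℕ
𝒵 α = proj₁ (curves α)

Exponents : ℕ → Set
Exponents n = Vec ℕ n

-- Formal sums of terms c·xᵉ.  Repeated exponents are allowed, so only the
-- collected coefficients given by coeff are meaningful.
Polynomial : ℕ → Set
Polynomial n = List (ℤ × Exponents n)

coeff : ∀ {n} → Polynomial n → Exponents n → ℤ
coeff []             e  = 0ℤ
coeff ((c , e′) ∷ f) e  = (if does (≡-dec ℕ._≟_ e′ e) then c else 0ℤ) ℤ.+ coeff f e

eval : ∀ {n} → Polynomial n → Vector ℤ n → ℤ
eval []            x = 0ℤ
eval ((c , e) ∷ f) x = c ℤ.* product (λ i → x i ℤ.^ Vec.lookup e i) ℤ.+ eval f x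

-- In particular the zero polynomial is homogeneous of every degree.
IsHomogeneous : ∀ {n} → ℕ → Polynomial n → Set
IsHomogeneous d f = ∀ e → coeff f e ≢ 0ℤ → Vec.sum e ≡ d

{-# OPTIONS --safe #-}

-- For arbitrary integer polynomials, the class of gcd (f₁ α , f₂ α) being
-- divisible by 3 or not depends only on α mod 3.  The number of curves behaves
-- differently: 𝒵 (4 , 1 , 2 , 1) = 3 and 𝒵 (1 , 1 , 2 , 1) = 2.  Prepending to α
-- the sum of its entries preserves both the congruence mod 3 and the number of
-- curves, which carries the example to every n ≥ 4.
module Submission where

open import Defs
open import Data.Fin.Base using (Fin; zero; suc; toℕ; fromℕ<)
open import Data.Fin.Properties using
  (toℕ<n; toℕ-fromℕ<; toℕ-injective; cantor-schröder-bernstein)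
open import Data.Integer.Base as ℤ using (ℤ; +_; 0ℤ; 1ℤ)
import Data.Integer.Divisibility.Signed as ℤ
open import Data.Integer.GCD using (gcd)
import Data.Integer.Properties as ℤ
import Data.Integer.Tactic.RingSolver as ℤ-Solver
open import Data.List.Base using ([]; _∷_)
open import Data.Nat.Base using
  (ℕ; zero; suc; _+_; _*_; _∸_; _≤_; _<_; z≤n; s≤s; _≤′_; ≤′-refl; ≤′-step)
import Data.Nat.Divisibility as ℕ
import Data.Nat.GCD as ℕ
import Data.Nat.Properties as ℕ
open import Data.Nat.Tactic.RingSolver using (solve-∀)
open import Data.Product.Base using (∃; _×_; _,_; proj₁; proj₂)
open import Data.Sum.Base using (_⊎_; inj₁; inj₂)
import Data.Vec.Base as Vec
open import Data.Vec.Functional as Vector using (Vector)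
open import Algebra.Properties.CommutativeMonoid.Sum ℕ.+-0-commutativeMonoid using (sum)
open import Algebra.Properties.CommutativeMonoid.Sum ℤ.*-1-commutativeMonoid
  using () renaming (sum to product)
open import Function.Base using (_∘_)
open import Function.Bundles using (Bijection; Inverse)
import Function.Construct.Composition as Composition
import Function.Construct.Symmetry as Symmetry
open import Function.Properties.Bijection using (Bijection⇒Inverse)
open import Function.Properties.Inverse using (Inverse⇒Bijection)
open import Relation.Binary.Bundles using (Setoid)
open import Relation.Binary.Construct.Closure.Equivalence as Eq using (EqClosure)
open import Relation.Binary.PropositionalEquality
open import Relation.Nullary using (¬_; yes; no; contradiction)
open import Relation.Nullary.Decidable using (from-no)

-- Congruences of integers and of polynomial values.

infix 4 _≡_[mod_]

-- A record rather than bare divisibility of `x - y`, so that `x` and `y` can be inferred from the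
-- type of a congruence.
record _≡_[mod_] (x y d : ℤ) : Set where
  constructor congruent
  field ∣difference : d ℤ.∣ x ℤ.- y

module _ {d : ℤ} where

  mod-reflexive : ∀ {x y} → x ≡ y → x ≡ y [mod d ]
  mod-reflexive {x} refl = congruent (subst (d ℤ.∣_) (sym (ℤ.+-inverseʳ x)) (ℤ.divides 0ℤ refl))

  +-mod-cong : ∀ {x y u v} → x ≡ y [mod d ] → u ≡ v [mod d ] → x ℤ.+ u ≡ y ℤ.+ v [mod d ]
  +-mod-cong {x} {y} {u} {v} (congruent p) (congruent q) =
    congruent (subst (d ℤ.∣_) (identity x y u v) (ℤ.∣m∣n⇒∣m+n p q))
    where
    identity : ∀ x y u v → (x ℤ.- y) ℤ.+ (u ℤ.- v) ≡ (x ℤ.+ u) ℤ.- (y ℤ.+ v)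
    identity = ℤ-Solver.solve-∀

  *-mod-cong : ∀ {x y u v} → x ≡ y [mod d ] → u ≡ v [mod d ] → x ℤ.* u ≡ y ℤ.* v [mod d ]
  *-mod-cong {x} {y} {u} {v} (congruent p) (congruent q) =
    congruent (subst (d ℤ.∣_) (identity x y u v)
      (ℤ.∣m∣n⇒∣m+n (ℤ.∣m⇒∣m*n u p) (ℤ.∣n⇒∣m*n y q)))
    where
    identity : ∀ x y u v → (x ℤ.- y) ℤ.* u ℤ.+ y ℤ.* (u ℤ.- v) ≡ x ℤ.* u ℤ.- y ℤ.* v
    identity = ℤ-Solver.solve-∀

  ^-mod-cong : ∀ {x y} k → x ≡ y [mod d ] → x ℤ.^ k ≡ y ℤ.^ k [mod d ]
  ^-mod-cong zero    p = mod-reflexive refl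
  ^-mod-cong (suc k) p = *-mod-cong p (^-mod-cong k p)

  product-mod-cong : ∀ {n} {x y : Vector ℤ n} → (∀ ℓ → x ℓ ≡ y ℓ [mod d ]) →
                     product x ≡ product y [mod d ]
  product-mod-cong {zero}  p = mod-reflexive refl
  product-mod-cong {suc n} p = *-mod-cong (p zero) (product-mod-cong (p ∘ suc))

  eval-mod-cong : ∀ {n} (f : Polynomial n) {x y : Vector ℤ n} →
                  (∀ ℓ → x ℓ ≡ y ℓ [mod d ]) → eval f x ≡ eval f y [mod d ]
  eval-mod-cong []            p = mod-reflexive refl
  eval-mod-cong ((c , e) ∷ f) p =
    +-mod-cong (*-mod-cong (mod-reflexive {c} refl)
                           (product-mod-cong λ ℓ → ^-mod-cong (Vec.lookup e ℓ) (p ℓ)))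
               (eval-mod-cong f p)

  sum-mod-cong : ∀ {n} {α β : Vector ℕ n} → (∀ ℓ → + α ℓ ≡ + β ℓ [mod d ]) →
                 + sum α ≡ + sum β [mod d ]
  sum-mod-cong {zero}  p = mod-reflexive refl
  sum-mod-cong {suc n} p = +-mod-cong (p zero) (sum-mod-cong (p ∘ suc))

  ∣-resp-mod : ∀ {x y} → x ≡ y [mod d ] → d ℤ.∣ x → d ℤ.∣ y
  ∣-resp-mod {x} {y} (congruent p) d∣x = subst (d ℤ.∣_) (identity x y) (ℤ.∣m∣n⇒∣m-n d∣x p)
    where
    identity : ∀ x y → x ℤ.- (x ℤ.- y) ≡ y
    identity = ℤ-Solver.solve-∀

-- A number divides a gcd exactly when it divides both arguments, and divisibility by `d` of a
-- polynomial value depends only on the arguments modulo `d`.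
gcd-mod-cong : ∀ {d n} (f g : Polynomial n) {x y : Vector ℤ n} →
               (∀ ℓ → x ℓ ≡ y ℓ [mod + d ]) →
               d ℕ.∣ ℕ.gcd ℤ.∣ eval f x ∣ ℤ.∣ eval g x ∣ →
               d ℕ.∣ ℕ.gcd ℤ.∣ eval f y ∣ ℤ.∣ eval g y ∣
gcd-mod-cong {d} f g {x} {y} p d∣gcd =
  ℕ.gcd-greatest (transfer f (ℕ.∣-trans d∣gcd (ℕ.gcd[m,n]∣m _ ℤ.∣ eval g x ∣)))
                 (transfer g (ℕ.∣-trans d∣gcd (ℕ.gcd[m,n]∣n ℤ.∣ eval f x ∣ _)))
  where
  transfer : ∀ h → d ℕ.∣ ℤ.∣ eval h x ∣ → d ℕ.∣ ℤ.∣ eval h y ∣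
  transfer h = ℤ.∣⇒∣ᵤ ∘ ∣-resp-mod (eval-mod-cong h p) ∘ ℤ.∣ᵤ⇒∣

-- Comparing numbers of curves.

Fin-Inverse⇒≡ : ∀ {m n} → Inverse (setoid (Fin m)) (setoid (Fin n)) → m ≡ n
Fin-Inverse⇒≡ I = cantor-schröder-bernstein
  (Bijection.injective (Inverse⇒Bijection I))
  (Bijection.injective (Inverse⇒Bijection (Symmetry.inverse I)))

-- Both sets of curves are in bijection with some `Fin k`, so matching them forces equal counts,
-- however each was enumerated.
𝒵-cong : ∀ {m n} {α : Vector ℕ m} {β : Vector ℕ n} →
         Inverse (Curves α) (Curves β) → 𝒵 α ≡ 𝒵 β
𝒵-cong {α = α} {β} I = Fin-Inverse⇒≡ (Composition.inverse
  (Symmetry.inverse (Bijection⇒Inverse (proj₂ (curves α))))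
  (Composition.inverse I (Bijection⇒Inverse (proj₂ (curves β)))))

-- Positions and rainbow arcs.

pos≤ : ∀ {m} (x : Fin m) → pos x ≤ m
pos≤ = toℕ<n

pos-injective : ∀ {m} {x y : Fin m} → pos x ≡ pos y → x ≡ y
pos-injective = toℕ-injective ∘ ℕ.suc-injective

point : ∀ {m} k → 0 < k → k ≤ m → ∃ λ (x : Fin m) → pos x ≡ k
point (suc k) _ k<m = fromℕ< k<m , cong suc (toℕ-fromℕ< k<m)

-- The right end of an arc is characterised by a sum of positions rather than
-- by a truncated difference.
module _ {m s a : ℕ} {x y : Fin m} where

  rainbow⁺ : (i : Fin a) → pos x ≡ s + pos i → pos x + pos y ≡ s + (s + 2 * a + 1) →
             Rainbow s a x y
  rainbow⁺ i x≡ xy≡ = i , x≡ , (begin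
    pos y                            ≡⟨ ℕ.m+n∸m≡n (pos i) (pos y) ⟨
    pos i + pos y ∸ pos i            ≡⟨ cong (_∸ pos i) iy≡ ⟩
    s + 2 * a + 1 ∸ pos i            ∎)
    where
    open ≡-Reasoning
    iy≡ : pos i + pos y ≡ s + 2 * a + 1
    iy≡ = ℕ.+-cancelˡ-≡ s _ _
      (trans (sym (ℕ.+-assoc s (pos i) (pos y))) (trans (cong (_+ pos y) (sym x≡)) xy≡))

  rainbow⁻ : (r : Rainbow s a x y) →
             pos x ≡ s + pos (proj₁ r) × pos x + pos y ≡ s + (s + 2 * a + 1)
  rainbow⁻ (i , x≡ , y≡) = x≡ , (begin
    pos x + pos y                            ≡⟨ cong₂ _+_ x≡ y≡ ⟩
    s + pos i + (s + 2 * a + 1 ∸ pos i)      ≡⟨ ℕ.+-assoc s (pos i) _ ⟩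
    s + (pos i + (s + 2 * a + 1 ∸ pos i))    ≡⟨ cong (_+_ s) (ℕ.m+[n∸m]≡n i≤) ⟩
    s + (s + 2 * a + 1)                      ∎)
    where
    open ≡-Reasoning
    -- This bound makes the truncated difference in `Rainbow` exact.
    i≤ : pos i ≤ s + 2 * a + 1
    i≤ = ℕ.≤-trans (pos≤ i) (ℕ.≤-trans (ℕ.m≤m+n a (a + 0))
           (ℕ.≤-trans (ℕ.m≤n+m (2 * a) s) (ℕ.m≤m+n _ 1)))

  rainbow-left< : Rainbow s a x y → s < pos x
  rainbow-left< (i , x≡ , _) = subst (s <_) (sym x≡) (ℕ.m<m+n s (s≤s z≤n))

  rainbow-right< : Rainbow s a x y → s < pos y
  rainbow-right< (i , _ , y≡) = subst (s <_) (sym y≡) (ℕ.m+n≤o⇒m≤o∸n (suc s) (begin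
    suc s + pos i    ≤⟨ ℕ.+-monoʳ-≤ (suc s) (ℕ.≤-trans (pos≤ i) (ℕ.m≤m+n a (a + 0))) ⟩
    suc (s + 2 * a)  ≡⟨ ℕ.+-comm 1 _ ⟩
    s + 2 * a + 1    ∎))
    where open ℕ.≤-Reasoning

-- With offset 0 the index of an arc is the position of its left end.
rainbow₀⁺ : ∀ {m a} {x y : Fin m} → pos x ≤ a → pos x + pos y ≡ 2 * a + 1 → Rainbow 0 a x y
rainbow₀⁺ {x = x} x≤a with i , i≡ ← point (pos x) (s≤s z≤n) x≤a =
  rainbow⁺ {s = 0} i (sym i≡)

rainbow₀⁻ : ∀ {m a} {x y : Fin m} → Rainbow 0 a x y → pos x ≤ a × pos x + pos y ≡ 2 * a + 1
rainbow₀⁻ {a = a} r with x≡ , xy≡ ← rainbow⁻ {s = 0} r =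
  subst (_≤ a) (sym x≡) (pos≤ (proj₁ r)) , xy≡

-- Folding the extended meander onto the original one.

extend : ∀ {n} → Vector ℕ n → Vector ℕ (suc n)
extend α = sum α Vector.∷ α

-- The lower arcs of the extended meander join each point x of its left half to
-- the point 2 S + 1 - x of the original meander, which occupies the right half.
-- Under this folding the new upper arcs become the original lower arcs.
module Extend {n : ℕ} (α : Vector ℕ n) where

  β : Vector ℕ (suc n)
  β = extend α

  -- `d` is the number of points of the original meander and also the size of each half of the
  -- extended one.
  S d : ℕ
  S = sum α
  d = 2 * S

  d+d : 2 * (S + S) ≡ d + d
  d+d = ℕ.*-distribˡ-+ 2 S S

  _∼_ : Point β → Point β → Set
  _∼_ = EqClosure (Arc β)

  open Setoid (Curves β) using () renaming (trans to _▻_; sym to inv; reflexive to ∼-reflexive)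

  ι-point : (y : Point α) → ∃ λ (x : Point β) → pos x ≡ d + pos y
  ι-point y = point (d + pos y) (ℕ.≤-trans (s≤s z≤n) (ℕ.m≤n+m (pos y) d))
    (subst (d + pos y ≤_) (sym d+d) (ℕ.+-monoʳ-≤ d (pos≤ y)))

  ι : Point α → Point β
  ι = proj₁ ∘ ι-point

  pos-ι : ∀ y → pos (ι y) ≡ d + pos y
  pos-ι = proj₂ ∘ ι-point

  left-point : (x : Point β) → pos x ≤ d → ∃ λ (y : Point α) → pos x + pos y ≡ d + 1
  left-point x x≤d =
    proj₁ p , trans (cong (_+_ (pos x)) (proj₂ p)) (ℕ.m+[n∸m]≡n (ℕ.≤-trans x≤d (ℕ.m≤m+n d 1)))
    where
    p = point (d + 1 ∸ pos x)
          (ℕ.m<n⇒0<n∸m (subst (pos x <_) (ℕ.+-comm 1 d) (s≤s x≤d)))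
          (subst (λ k → k ∸ pos x ≤ d) (ℕ.+-comm 1 d) (ℕ.m∸n≤m d (toℕ x)))

  right-point : (x : Point β) → d < pos x → ∃ λ (y : Point α) → pos x ≡ d + pos y
  right-point x d<x =
    proj₁ p , sym (trans (cong (_+_ d) (proj₂ p)) (ℕ.m+[n∸m]≡n (ℕ.<⇒≤ d<x)))
    where
    p = point (pos x ∸ d) (ℕ.m<n⇒0<n∸m d<x)
          (ℕ.≤-trans (ℕ.∸-monoˡ-≤ d (subst (pos x ≤_) d+d (pos≤ x))) (ℕ.≤-reflexive (ℕ.m+n∸n≡m d d)))

  -- The folding: the left half is reflected, `x` going to `d + 1 - x`, and the right half is
  -- translated back by `d`.
  ρ : Point β → Point α
  ρ x with pos x ℕ.≤? d
  ... | yes x≤d = proj₁ (left-point x x≤d)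
  ... | no  x≰d = proj₁ (right-point x (ℕ.≰⇒> x≰d))

  ρ-left : ∀ x → pos x ≤ d → pos x + pos (ρ x) ≡ d + 1
  ρ-left x x≤d with pos x ℕ.≤? d
  ... | yes x≤d′ = proj₂ (left-point x x≤d′)
  ... | no  x≰d  = contradiction x≤d x≰d

  ρ-right : ∀ x → d < pos x → pos x ≡ d + pos (ρ x)
  ρ-right x d<x with pos x ℕ.≤? d
  ... | yes x≤d = contradiction x≤d (ℕ.<⇒≱ d<x)
  ... | no  x≰d = proj₂ (right-point x (ℕ.≰⇒> x≰d))

  d<pos-ι : ∀ y → d < pos (ι y)
  d<pos-ι y = subst (d <_) (sym (pos-ι y)) (ℕ.m<m+n d (s≤s z≤n))

  ρ-ι : ∀ y → ρ (ι y) ≡ y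
  ρ-ι y = pos-injective (ℕ.+-cancelˡ-≡ d _ _ (trans (sym (ρ-right (ι y) (d<pos-ι y))) (pos-ι y)))

  ι-ρ : ∀ x → d < pos x → ι (ρ x) ≡ x
  ι-ρ x d<x = pos-injective (trans (pos-ι (ρ x)) (sym (ρ-right x d<x)))

  -- Images of arcs under `ι` and `ρ`.

  offset-suc : ∀ ℓ → offset β (suc ℓ) ≡ d + offset α ℓ
  offset-suc ℓ = ℕ.*-distribˡ-+ 2 S _

  shifted-sum : ∀ s a x y → x + y ≡ s + (s + 2 * a + 1) →
                (d + x) + (d + y) ≡ (d + s) + ((d + s) + 2 * a + 1)
  shifted-sum s a x y eq = begin
    (d + x) + (d + y)                  ≡⟨ identity₁ d x y ⟩
    (d + d) + (x + y)                  ≡⟨ cong (_+_ (d + d)) eq ⟩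
    (d + d) + (s + (s + 2 * a + 1))    ≡⟨ identity₂ d s a ⟩
    (d + s) + ((d + s) + 2 * a + 1)    ∎
    where
    open ≡-Reasoning
    identity₁ : ∀ d x y → (d + x) + (d + y) ≡ (d + d) + (x + y)
    identity₁ = solve-∀
    identity₂ : ∀ d s a → (d + d) + (s + (s + 2 * a + 1)) ≡ (d + s) + ((d + s) + 2 * a + 1)
    identity₂ = solve-∀

  ι-rainbow : ∀ {s a x y} → Rainbow s a x y → Rainbow (d + s) a (ι x) (ι y)
  ι-rainbow {s} {a} {x} {y} r@(i , _) with x≡ , xy≡ ← rainbow⁻ r = rainbow⁺ i
    (trans (pos-ι x) (trans (cong (_+_ d) x≡) (sym (ℕ.+-assoc d s (pos i)))))
    (trans (cong₂ _+_ (pos-ι x) (pos-ι y)) (shifted-sum s a (pos x) (pos y) xy≡))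

  -- Both ends lie beyond `d`, where `ρ` is a translation.
  ρ-rainbow : ∀ {s a x y} → Rainbow (d + s) a x y → Rainbow s a (ρ x) (ρ y)
  ρ-rainbow {s} {a} {x} {y} r@(i , x≡ , y≡) = i ,
    ℕ.+-cancelˡ-≡ d _ _ (trans (sym (ρ-right x d<x)) (trans x≡ (ℕ.+-assoc d s (pos i)))) ,
    (begin
      pos (ρ y)                              ≡⟨ ℕ.m+n∸m≡n d _ ⟨
      d + pos (ρ y) ∸ d                      ≡⟨ cong (_∸ d) (ρ-right y d<y) ⟨
      pos y ∸ d                              ≡⟨ cong (_∸ d) y≡ ⟩
      d + s + 2 * a + 1 ∸ pos i ∸ d          ≡⟨ ℕ.∸-+-assoc (d + s + 2 * a + 1) (pos i) d ⟩
      d + s + 2 * a + 1 ∸ (pos i + d)        ≡⟨ cong₂ _∸_ (assoc d s (2 * a)) (ℕ.+-comm (pos i) d) ⟩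
      d + (s + 2 * a + 1) ∸ (d + pos i)      ≡⟨ ℕ.[m+n]∸[m+o]≡n∸o d _ (pos i) ⟩
      s + 2 * a + 1 ∸ pos i                  ∎)
    where
    open ≡-Reasoning
    d≤d+s = ℕ.m≤m+n d s
    d<x = ℕ.≤-<-trans d≤d+s (rainbow-left< r)
    d<y = ℕ.≤-<-trans d≤d+s (rainbow-right< r)
    assoc : ∀ d s t → d + s + t + 1 ≡ d + (s + t + 1)
    assoc = solve-∀

  S+S≡d : S + S ≡ d
  S+S≡d = cong (_+_ S) (sym (ℕ.+-identityʳ S))

  -- Applied to positions, which are successors: two of them with sum `d + 1` both lie in the left
  -- half.
  ≤d : ∀ {p q} → p + suc q ≡ d + 1 → p ≤ d
  ≤d {p} {q} eq = ℕ.≤-trans (ℕ.m≤m+n p q)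
    (ℕ.≤-reflexive (ℕ.suc-injective (trans (sym (ℕ.+-suc p q)) (trans eq (ℕ.+-comm d 1)))))

  fold : ∀ u y → pos u + pos y ≡ d + 1 → u ∼ ι y
  fold u y eq = Eq.return (inj₂ (rainbow₀⁺ (subst (pos u ≤_) (sym S+S≡d) (≤d eq)) (begin
    pos u + pos (ι y)      ≡⟨ cong (_+_ (pos u)) (pos-ι y) ⟩
    pos u + (d + pos y)    ≡⟨ swap (pos u) d (pos y) ⟩
    d + (pos u + pos y)    ≡⟨ cong (_+_ d) eq ⟩
    d + (d + 1)            ≡⟨ ℕ.+-assoc d d 1 ⟨
    d + d + 1              ≡⟨ cong (_+ 1) d+d ⟨
    2 * (S + S) + 1        ∎)))
    where
    open ≡-Reasoning
    swap : ∀ u d y → u + (d + y) ≡ d + (u + y)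
    swap = solve-∀

  left-half : (y : Point α) → ∃ λ (x : Point β) → pos x ≡ pos y
  left-half y = point (pos y) (s≤s z≤n)
    (ℕ.≤-trans (pos≤ y) (subst (d ≤_) (sym d+d) (ℕ.m≤m+n d d)))

  ι-arc : ∀ {x y} → Arc α x y → ι x ∼ ι y
  ι-arc {x} {y} (inj₁ (ℓ , r)) = Eq.return (inj₁ (suc ℓ ,
    subst (λ s → Rainbow s (α ℓ) (ι x) (ι y)) (sym (offset-suc ℓ)) (ι-rainbow r)))
  -- A lower arc unfolds into three arcs: a lower one between `ι x` and `v`, a new upper one between
  -- `v` and `u`, and a lower one between `u` and `ι y`. Here `u` and `v` are the left-half points
  -- with the positions of `x` and `y`.
  ι-arc {x} {y} (inj₂ r)
    with x≤S , xy≡ ← rainbow₀⁻ r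
       | u , u≡ ← left-half x
       | v , v≡ ← left-half y
    = inv (fold v x (trans (cong (_+ pos x) v≡) (trans (ℕ.+-comm (pos y) (pos x)) xy≡)))
    ▻ (inv (Eq.return (inj₁ (zero , rainbow₀⁺ (subst (_≤ S) (sym u≡) x≤S)
                                              (trans (cong₂ _+_ u≡ v≡) xy≡))))
    ▻ fold u y (trans (cong (_+ pos y) u≡) xy≡))

  ρ-arc : ∀ {x y} → Arc β x y → EqClosure (Arc α) (ρ x) (ρ y)
  -- The reflection exchanges the positions of the two ends, so the image is a lower arc traversed
  -- backwards.
  ρ-arc {x} {y} (inj₁ (zero , r)) with x≤S , xy≡ ← rainbow₀⁻ r =
    Eq.symmetric (Arc α) (Eq.return (inj₂ (rainbow₀⁺
      (subst (_≤ S) (sym ρy≡x) x≤S)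
      (trans (cong₂ _+_ ρy≡x ρx≡y) xy≡))))
    where
    yx≡ = trans (ℕ.+-comm (pos y) (pos x)) xy≡
    ρx≡y : pos (ρ x) ≡ pos y
    ρx≡y = ℕ.+-cancelˡ-≡ (pos x) _ _ (trans (ρ-left x (≤d xy≡)) (sym xy≡))
    ρy≡x : pos (ρ y) ≡ pos x
    ρy≡x = ℕ.+-cancelˡ-≡ (pos y) _ _ (trans (ρ-left y (≤d yx≡)) (sym yx≡))
  ρ-arc {x} {y} (inj₁ (suc ℓ , r)) = Eq.return (inj₁ (ℓ ,
    ρ-rainbow (subst (λ s → Rainbow s (α ℓ) x y) (offset-suc ℓ) r)))
  -- A lower arc crosses from the left half to the right half, and the folding collapses it to a
  -- single point.
  ρ-arc {x} {y} (inj₂ r) with x≤ , xy≡ ← rainbow₀⁻ r =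
    Setoid.reflexive (Curves α) (pos-injective (ℕ.+-cancelˡ-≡ (pos x + d) _ _ (begin
      pos x + d + pos (ρ x)      ≡⟨ swap (pos x) d (pos (ρ x)) ⟩
      d + (pos x + pos (ρ x))    ≡⟨ cong (_+_ d) (ρ-left x x≤d) ⟩
      d + (d + 1)                ≡⟨ ℕ.+-assoc d d 1 ⟨
      d + d + 1                  ≡⟨ xy≡′ ⟨
      pos x + pos y              ≡⟨ cong (_+_ (pos x)) (ρ-right y d<y) ⟩
      pos x + (d + pos (ρ y))    ≡⟨ ℕ.+-assoc (pos x) d _ ⟨
      pos x + d + pos (ρ y)      ∎)))
    where
    open ≡-Reasoning
    swap : ∀ u d y → u + d + y ≡ d + (u + y)
    swap = solve-∀
    x≤d = subst (pos x ≤_) S+S≡d x≤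
    xy≡′ : pos x + pos y ≡ d + d + 1
    xy≡′ = trans xy≡ (cong (_+ 1) d+d)
    d<y : d < pos y
    d<y = ℕ.+-cancelˡ-≤ d _ _ (subst (_≤ d + pos y) (trans xy≡′ (trans (ℕ.+-assoc d d 1)
            (cong (_+_ d) (ℕ.+-comm d 1)))) (ℕ.+-monoˡ-≤ (pos y) x≤d))

  -- A left point differs from `ι (ρ x)` but is joined to it by a lower arc; a right point is fixed.
  ι-ρ∼ : ∀ x → ι (ρ x) ∼ x
  ι-ρ∼ x = by-side (ℕ.≤-<-connex (pos x) d)
    where
    by-side : pos x ≤ d ⊎ d < pos x → ι (ρ x) ∼ x
    by-side (inj₁ x≤d) = inv (fold x (ρ x) (ρ-left x x≤d))
    by-side (inj₂ d<x) = ∼-reflexive (ι-ρ x d<x)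

  ι-cong : ∀ {x y} → EqClosure (Arc α) x y → ι x ∼ ι y
  ι-cong = Eq.gfold (Eq.isEquivalence (Arc β)) ι ι-arc

  ρ-cong : ∀ {x y} → x ∼ y → EqClosure (Arc α) (ρ x) (ρ y)
  ρ-cong = Eq.gfold (Eq.isEquivalence (Arc α)) ρ ρ-arc

  curves-inverse : Inverse (Curves β) (Curves α)
  curves-inverse = record
    { to        = ρ
    ; from      = ι
    ; to-cong   = ρ-cong
    ; from-cong = ι-cong
    ; inverse   = (λ {y} x∼ιy → subst (EqClosure (Arc α) _) (ρ-ι y) (ρ-cong x∼ιy))
                , (λ {x} y∼ρx → ι-cong y∼ρx ▻ ι-ρ∼ x)
    }

𝒵-extend : ∀ {n} (α : Vector ℕ n) → 𝒵 (extend α) ≡ 𝒵 α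
𝒵-extend α = 𝒵-cong {α = extend α} {α} (Extend.curves-inverse α)

-- Pairs of vectors congruent modulo 3 whose counts differ in divisibility by 3.

Positive : ∀ {n} → Vector ℕ n → Set
Positive α = ∀ ℓ → 0 < α ℓ

extend-positive : ∀ {n} {α : Vector ℕ (suc n)} → Positive α → Positive (extend α)
extend-positive α>0 zero    = ℕ.≤-trans (α>0 zero) (ℕ.m≤m+n _ _)
extend-positive α>0 (suc ℓ) = α>0 ℓ

-- The length is `suc n` because prepending the sum preserves positivity only for nonempty vectors:
-- the empty sum is 0.
record Mod3Discrepancy (n : ℕ) : Set where
  field
    α β   : Vector ℕ (suc n)
    α>0   : Positive α
    β>0   : Positive β
    α≡β   : ∀ ℓ → + α ℓ ≡ + β ℓ [mod + 3 ]
    3∣𝒵α  : 3 ℕ.∣ 𝒵 α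
    3∤𝒵β  : ¬ 3 ℕ.∣ 𝒵 β

discrepancy₄ : Mod3Discrepancy 3
discrepancy₄ = record
  -- This is (4, 1, 2, 1), with 4 = 1 + 2 + 1 congruent to 1 modulo 3. Its count is read off from
  -- (1, 2, 1), a meander on 8 points instead of 16.
  { α    = extend α₀
  ; β    = β₀
  ; α>0  = extend-positive λ { zero → s≤s z≤n ; (suc zero) → s≤s z≤n ; (suc (suc zero)) → s≤s z≤n }
  ; β>0  = λ { zero → s≤s z≤n ; (suc zero) → s≤s z≤n ; (suc (suc zero)) → s≤s z≤n
             ; (suc (suc (suc zero))) → s≤s z≤n }
  ; α≡β  = λ { zero → congruent (ℤ.divides 1ℤ refl) ; (suc ℓ) → mod-reflexive refl }
  ; 3∣𝒵α = subst (3 ℕ.∣_) (sym (trans (𝒵-extend α₀) 𝒵α₀≡3)) ℕ.∣-refl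
  ; 3∤𝒵β = λ 3∣ → from-no (3 ℕ.∣? 2) (subst (3 ℕ.∣_) 𝒵β₀≡2 3∣)
  }
  where
  α₀ : Vector ℕ 3
  α₀ = 1 Vector.∷ 2 Vector.∷ 1 Vector.∷ Vector.[]
  β₀ : Vector ℕ 4
  β₀ = 1 Vector.∷ α₀
  -- Both counts are found by evaluating the enumeration of classes behind `𝒵`.
  𝒵α₀≡3 : 𝒵 α₀ ≡ 3
  𝒵α₀≡3 = refl
  𝒵β₀≡2 : 𝒵 β₀ ≡ 2
  𝒵β₀≡2 = refl

discrepancy-extend : ∀ {n} → Mod3Discrepancy n → Mod3Discrepancy (suc n)
discrepancy-extend D = record
  { α    = extend α
  ; β    = extend β
  ; α>0  = extend-positive α>0
  ; β>0  = extend-positive β>0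
  ; α≡β  = λ { zero → sum-mod-cong α≡β ; (suc ℓ) → α≡β ℓ }
  ; 3∣𝒵α = subst (3 ℕ.∣_) (sym (𝒵-extend α)) 3∣𝒵α
  ; 3∤𝒵β = 3∤𝒵β ∘ subst (3 ℕ.∣_) (𝒵-extend β)
  }
  where open Mod3Discrepancy D

-- `≤′` grows on the right, so each of its steps above 3 prepends one entry.
discrepancy : ∀ {n} → 3 ≤′ n → Mod3Discrepancy n
discrepancy ≤′-refl       = discrepancy₄
discrepancy (≤′-step 3≤n) = discrepancy-extend (discrepancy 3≤n)

theorem5p3 : (n : ℕ) → 4 ≤ n →
    ¬ (∃ λ (f₁ : Polynomial n) → ∃ λ (f₂ : Polynomial n) →
    (∃ λ (d₁ : ℕ) → IsHomogeneous d₁ f₁) ×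
    (∃ λ (d₂ : ℕ) → IsHomogeneous d₂ f₂) ×
    ((α : Vector ℕ n) → (∀ ℓ → 0 < α ℓ) →
    + 𝒵 α ≡ gcd (eval f₁ (λ ℓ → + α ℓ)) (eval f₂ (λ ℓ → + α ℓ))))
theorem5p3 (suc n) (s≤s 3≤n) (f₁ , f₂ , _ , _ , 𝒵≡gcd) =
  3∤𝒵β (subst (3 ℕ.∣_) (sym (ℤ.+-injective (𝒵≡gcd β β>0)))
    (gcd-mod-cong f₁ f₂ α≡β
      (subst (3 ℕ.∣_) (ℤ.+-injective (𝒵≡gcd α α>0)) 3∣𝒵α)))
  where open Mod3Discrepancy (discrepancy (ℕ.≤⇒≤′ 3≤n))
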